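{- There is an absolute constant $C>0$ such that for every even positive integer $n$ and every $i\in[n]=\{1,\dots,n\}$, the bijection $\psi\colon\{0,1\}^n\to\mathcal{B}_n$ defined in the context satisfies \[ \Pr_{x}[\psi_i(x)=x_i]>1-\frac{C}{\sqrt n}, \] where $x$ is uniformly distributed on $\{0,1\}^n$ and $\psi_i(x)$ denotes the $i$-th bit of $\psi(x)$.
   Context: $|x|$ denotes the Hamming weight of a binary string $x$, $\circ$ denotes concatenation, and $\mathcal{B}_n=\{x\in\{0,1\}^{n+1}: |x|>n/2\}$. Marking stage. Given $x\in\{0,1\}^n$, all coordinates start unmarked. Repeatedly choose two unmarked coordinates $p<q$ with no unmarked coordinate strictly between them and with $x_p=1$, $x_q=0$, and mark both; stop when no such pair exists. The final set of marked coordinates does not depend on the choices made. When the process stops, the unmarked bits, read from left to right, form a string $0\cdots01\cdots1$. Chains. Let $i_1<\dots<i_m$ be the finally unmarked coordinates of $x$ (so $m\equiv n \pmod 2$), and let $k=(n-m)/2$. The chain containing $x$ is $\{c_k,c_{k+1},\dots,c_{n-k}\}$, where $c_r$ (for $k\le r\le n-k$) agrees with $x$ on all marked coordinates, equals $0$ on the $m-(r-k)$ leftmost unmarked coordinates and equals $1$ on the remaining $r-k$ unmarked coordinates. Then $|c_r|=r$. These chains (the De Bruijn–Tengbergen–Kruyswijk chains) partition $\{0,1\}^n$. The map $\psi$. For even $n$ and $x\in\{0,1\}^n$ lying in the chain $\{c_k,\dots,c_{n-k}\}$ with $x=c_j$, \[ \psi(x)=\begin{cases} c_{\frac{(n-k)+j}{2}}\circ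 1, & j\equiv n-k \pmod 2,\\[2pt] c_{\frac{(n-k)+j+1}{2}}\circ 0, & j\not\equiv n-k \pmod 2.\end{cases} \] This is a bijection from $\{0,1\}^n$ to $\mathcal{B}_n$. -}

module Defs where

open import Data.Bool using (Bool; true; false) renaming (_≟_ to _≟ᵇ_)
open import Data.Fin using (Fin; _<_)
open import Data.Fin.Properties using (any?; all?; _<?_)
open import Data.Fin.Subset using (Subset; inside; outside; _∈_; _∉_; _∪_; ⁅_⁆; ⊥; ∁; ∣_∣; _⊃_)
open import Data.Fin.Subset.Induction using (Acc; acc; ⊃-wellFounded)
open import Data.Fin.Subset.Properties using (_∈?_; x∈⁅x⁆; p⊆p∪q; x∈p∪q⁺)
open import Data.Integer using (+_)
open import Data.List using (List; []; _∷_; _++_; map; filter; length)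
open import Data.Nat using (ℕ; zero; suc; _+_; _∸_; _^_; _%_) renaming (_/_ to _div_; _≟_ to _≟ⁿ_)
open import Data.Nat.Properties using (m^n≢0)
open import Data.Product using (∃; ∃₂; _×_; _,_; proj₁)
open import Data.Rational.Unnormalised using (ℚᵘ; 0ℚᵘ; 1ℚᵘ; _/_; _*_; _-_) renaming (_<_ to _<ℚ_)
open import Data.Sum using (_⊎_; inj₁; inj₂)
open import Data.Vec using (Vec; []; _∷_; _∷ʳ_; lookup; count)
open import Relation.Binary.Construct.Closure.ReflexiveTransitive using (Star; ε; _◅_)
open import Relation.Binary.PropositionalEquality using (_≡_)
open import Relation.Nullary using (Dec; yes; no; ¬_; ¬?)
open import Relation.Nullary.Decidable using (_×-dec_; _→-dec_)
open import Relation.Unary using (Pred; Decidable)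
open import Level using (0ℓ)

private
  variable
    n : ℕ

-- Bit strings: true is 1 and false is 0; coordinates are numbered from 0.
Bits : ℕ → Set
Bits = Vec Bool

weight : Bits n → ℕ
weight = count (_≟ᵇ true)

-- In the marking stage, M is the set of coordinates marked so far.
Markable : Bits n → Subset n → Fin n → Fin n → Set
Markable x M p q =
  p < q × p ∉ M × q ∉ M ×
  (∀ r → p < r → r < q → r ∈ M) ×
  lookup x p ≡ true × lookup x q ≡ false

data Step (x : Bits n) (M : Subset n) : Subset n → Set where
  mark : ∀ p q → Markable x M p q → Step x M (M ∪ (⁅ p ⁆ ∪ ⁅ q ⁆))

Stuck : Bits n → Subset n → Set
Stuck x M = ¬ ∃₂ (Markable x M)

markable? : (x : Bits n) (M : Subset n) → Dec (∃₂ (Markable x M))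
markable? x M = any? λ p → any? λ q →
  p <? q ×-dec ¬? (p ∈? M) ×-dec ¬? (q ∈? M) ×-dec
  all? (λ r → p <? r →-dec r <? q →-dec r ∈? M) ×-dec
  lookup x p ≟ᵇ true ×-dec lookup x q ≟ᵇ false

Step⇒⊃ : ∀ {x : Bits n} {M M′} → Step x M M′ → M′ ⊃ M
Step⇒⊃ {M = M} (mark p q (_ , p∉M , _)) =
  p⊆p∪q {p = M} (⁅ p ⁆ ∪ ⁅ q ⁆) ,
  p , x∈p∪q⁺ {p = M} (inj₂ (p⊆p∪q {p = ⁅ p ⁆} ⁅ q ⁆ (x∈⁅x⁆ p))) , p∉M

runMarking : (x : Bits n) (M : Subset n) → Acc _⊃_ M →
             ∃ λ M′ → Star (Step x) M M′ × Stuck x M′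
runMarking x M (acc rs) with markable? x M
... | no stuck = M , ε , stuck
... | yes (p , q , pq) =
  let s = mark p q pq
      M′ , steps , stuck = runMarking x _ (rs (Step⇒⊃ s))
  in M′ , s ◅ steps , stuck

-- One complete run of the marking process; the final set is the same for
-- every run, so the order in which runMarking picks pairs is immaterial.
marked : Bits n → Subset n
marked x = proj₁ (runMarking x ⊥ (⊃-wellFounded ⊥))

-- fill M x z agrees with x on M; off M it is 0 on the z leftmost coordinates
-- and 1 on the others.
fill : Subset n → Bits n → ℕ → Bits n
fill []            []      _       = []
fill (inside  ∷ M) (b ∷ x) z       = b     ∷ fill M x z
fill (outside ∷ M) (b ∷ x) zero    = true  ∷ fill M x zero
fill (outside ∷ M) (b ∷ x) (suc z) = false ∷ fill M x z

#unmarked : Bits n → ℕ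
#unmarked x = ∣ ∁ (marked x) ∣

-- The chain containing x is chain x r for bottom x ≤ r ≤ n ∸ bottom x.
bottom : Bits n → ℕ
bottom {n} x = (n ∸ #unmarked x) div 2

chain : Bits n → ℕ → Bits n
chain x r = fill (marked x) x (#unmarked x ∸ (r ∸ bottom x))

-- chain x r has weight r, so the index j with x = chain x j is the weight of x.
-- The map is intended for even n, where its image is
-- { y : Bits (suc n) | weight y > n / 2 }.
ψ : Bits n → Bits (suc n)
ψ {n} x with weight x % 2 ≟ⁿ (n ∸ bottom x) % 2
... | yes _ = chain x (((n ∸ bottom x) + weight x) div 2) ∷ʳ true
... | no  _ = chain x (((n ∸ bottom x) + weight x + 1) div 2) ∷ʳ false

allBits : ∀ n → List (Bits n)
allBits zero    = [] ∷ []
allBits (suc n) = map (false ∷_) (allBits n) ++ map (true ∷_) (allBits n)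

-- Probability of an event under the uniform distribution on Bits n.
Pr : ∀ n {P : Pred (Bits n) 0ℓ} → Decidable P → ℚᵘ
Pr n P? = _/_ (+ length (filter P? (allBits n))) (2 ^ n) {{m^n≢0 2 n}}

-- The real inequality p > 1 − C/√n, for rational p, C > 0 and n > 0: it says
-- that 1 − p < C/√n, where the right-hand side is the positive square root of
-- C²/n, i.e. that 1 − p is negative or (1 − p)² n < C².
infix 4 _>1-_/√_
_>1-_/√_ : ℚᵘ → ℚᵘ → ℕ → Set
p >1- C /√ n =
  1ℚᵘ - p <ℚ 0ℚᵘ ⊎ (1ℚᵘ - p) * (1ℚᵘ - p) * (+ n / 1) <ℚ C * C

{-# OPTIONS --safe #-}

-- Read 1 as an up-step and 0 as a down-step: the unmarked zeros are the steps at
-- which the walk reaches a new strict minimum, and ψ changes x_i only if i is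
-- such a step, of some level -t, and the remaining walk never goes down by t,
-- because only the later half of the unmarked zeros is raised. Summing over t,
-- the number of such x is at most Σ_t h(i,t) s(r,t), where h counts walks from t
-- hitting 0 first at step i, and s counts walks of the remaining length r that
-- stay positive from t. Since h(i,·) is minus the second difference of s(i-1,·),
-- s(r,·) is concave, and Abel summation bounds Σ_t h(i,t) and Σ_t t h(i,t) by
-- s(i-1,1) and 2^(i-1). With s(r,t) ≤ t s(r,1) if r is the larger part, and
-- s(r,t) ≤ 2^r otherwise, the bound s(m,1)² (m+1) ≤ 4^m on the central binomial
-- coefficient s(m,1) suffices in both cases.

module Submission where

open import Defs
open import Data.Bool using (true; false; _≟_)
open import Data.Fin using (Fin; zero; suc; toℕ; inject₁) renaming (_<_ to _<ᶠ_)
open import Data.Fin.Properties using (toℕ<n)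
open import Data.Fin.Subset using (Subset; inside; outside; _∈_; _∉_; _∪_; ⁅_⁆; ⊥; ∁; ∣_∣)
open import Data.Fin.Subset.Induction using (⊃-wellFounded)
open import Data.Fin.Subset.Properties using (∪-identityʳ; ∪-identityˡ; drop-there)
open import Data.Integer as ℤ using (+<+)
import Data.Integer.Properties as ℤ
open import Data.List using (List; []; _∷_; _++_; map; filter; length)
open import Data.List.Properties using (length-++; length-map; length-filter; map-++; map-∘)
open import Data.Nat hiding (_≟_)
open import Data.Nat.Combinatorics using (_C_; nCk≡nC[n∸k]; nCk+nC[k+1]≡[n+1]C[k+1]; nC1≡n; k>n⇒nCk≡0)
open import Data.Nat.Divisibility using (_∣_; divides)
open import Data.Nat.DivMod using (m*n/n≡m; +-distrib-/-∣ˡ; m/n*n≤m)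
open import Data.Nat.ListAction using (sum)
open import Data.Nat.ListAction.Properties using (sum-++)
open import Data.Nat.Properties renaming (_≟_ to _≟ⁿ_)
open import Data.Nat.Tactic.RingSolver using (solve-∀)
open import Data.Product using (∃; ∃₂; ∃-syntax; _×_; _,_; proj₁; proj₂)
open import Data.Rational.Unnormalised using (0ℚᵘ; 1ℚᵘ; *≡*; *<*; _≃_) renaming (_<_ to _<ℚ_; _/_ to _/ℚ_; _-_ to _-ℚ_)
import Data.Rational.Unnormalised.Properties as ℚ
open import Data.Sum using (_⊎_; inj₁; inj₂)
open import Data.Vec using (Vec; []; _∷_; _∷ʳ_; lookup; here; there)
open import Function using (_∘_; case_of_)
open import Level using (0ℓ)
open import Relation.Binary.Construct.Closure.ReflexiveTransitive using (Star; ε; _◅_)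
open import Relation.Binary.PropositionalEquality
open import Relation.Nullary using (¬_; yes; no; contradiction)
open import Relation.Unary using (Pred; Decidable)

private
  variable
    n : ℕ
    A : Set

-- Walks that stay positive and walks that first hit zero

-- surv r s counts the ±1 walks of length r from s that stay positive, and
-- hits u s those of length u + 1 from s that reach 0 only at the last step.
surv : ℕ → ℕ → ℕ
surv r       zero    = 0
surv zero    (suc s) = 1
surv (suc r) (suc s) = surv r s + surv r (2 + s)

hits : ℕ → ℕ → ℕ
hits u       zero          = 0
hits zero    (suc zero)    = 1
hits zero    (suc (suc s)) = 0
hits (suc u) (suc s)       = hits u s + hits u (2 + s)

-- Both families obey the same recurrence in the length. At length zero the second difference of the
-- indicator of positive heights is -1 at height 1 and 0 above it. Hence `surv u` is concave in the
-- height, with `hits u` measuring the concavity.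
hits-surv : ∀ u s → hits u (1 + s) + (surv u (2 + s) + surv u s) ≡ 2 * surv u (1 + s)
hits-surv zero    zero    = refl
hits-surv zero    (suc s) = refl
hits-surv (suc u) zero    = begin
  hits u 2 + (surv u 1 + surv u 3 + 0) ≡⟨ eq (hits u 2) (surv u 1) (surv u 3) ⟩
  hits u 2 + (surv u 3 + surv u 1)     ≡⟨ hits-surv u 1 ⟩
  2 * surv u 2                         ∎
  where
  open ≡-Reasoning
  eq : ∀ a b c → a + (b + c + 0) ≡ a + (c + b)
  eq = solve-∀
hits-surv (suc u) (suc s) = begin
  h₁ + h₃ + (s₂ + s₄ + (s₀ + s₂))     ≡⟨ eq h₁ h₃ s₀ s₂ s₄ ⟩
  h₁ + (s₂ + s₀) + (h₃ + (s₄ + s₂))   ≡⟨ cong₂ _+_ (hits-surv u s) (hits-surv u (2 + s)) ⟩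
  2 * s₁ + 2 * s₃                     ≡⟨ *-distribˡ-+ 2 s₁ s₃ ⟨
  2 * (s₁ + s₃)                       ∎
  where
  open ≡-Reasoning
  h₁ = hits u (1 + s)
  h₃ = hits u (3 + s)
  s₀ = surv u s
  s₁ = surv u (1 + s)
  s₂ = surv u (2 + s)
  s₃ = surv u (3 + s)
  s₄ = surv u (4 + s)
  eq : ∀ h₁ h₃ s₀ s₂ s₄ → h₁ + h₃ + (s₂ + s₄ + (s₀ + s₂)) ≡ h₁ + (s₂ + s₀) + (h₃ + (s₄ + s₂))
  eq = solve-∀

surv≤2^ : ∀ r s → surv r s ≤ 2 ^ r
surv≤2^ r       zero    = z≤n
surv≤2^ zero    (suc s) = ≤-refl
surv≤2^ (suc r) (suc s) = begin
  surv r s + surv r (2 + s) ≤⟨ +-mono-≤ (surv≤2^ r s) (surv≤2^ r (2 + s)) ⟩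
  2 ^ r + 2 ^ r             ≡⟨ cong (2 ^ r +_) (+-identityʳ (2 ^ r)) ⟨
  2 ^ suc r                 ∎
  where open ≤-Reasoning

C-halves : ∀ r → r C ⌊ r /2⌋ ≡ r C ⌈ r /2⌉
C-halves r = begin
  r C ⌊ r /2⌋             ≡⟨ nCk≡nC[n∸k] (⌊n/2⌋≤n r) ⟩
  r C (r ∸ ⌊ r /2⌋)       ≡⟨ cong (r C_) (begin
    r ∸ ⌊ r /2⌋                           ≡⟨ cong (_∸ ⌊ r /2⌋) (⌊n/2⌋+⌈n/2⌉≡n r) ⟨
    (⌊ r /2⌋ + ⌈ r /2⌉) ∸ ⌊ r /2⌋         ≡⟨ m+n∸m≡n ⌊ r /2⌋ ⌈ r /2⌉ ⟩
    ⌈ r /2⌉                               ∎) ⟩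
  r C ⌈ r /2⌉             ∎
  where open ≡-Reasoning

-- By reflection, `surv r s` counts the walks with displacement in (-s, s]. Raising s by one admits
-- the displacements -s and s + 1, of which exactly one has the parity of r. The induction uses only
-- Pascal's rule.
surv-suc : ∀ r s → surv r (suc s) ≡ surv r s + r C ⌊ suc (r + s) /2⌋
surv-suc zero    zero          = refl
surv-suc zero    (suc s)       = refl
surv-suc (suc r) zero    rewrite +-identityʳ r = begin
  surv r 2                                ≡⟨ surv-suc r 1 ⟩
  surv r 1 + r C ⌊ suc (r + 1) /2⌋        ≡⟨ cong₂ (λ a b → a + r C ⌊ suc b /2⌋) (surv-suc r 0) (+-comm r 1) ⟩
  r C ⌊ suc (r + 0) /2⌋ + r C suc ⌊ r /2⌋ ≡⟨ cong (λ a → r C ⌊ suc a /2⌋ + r C suc ⌊ r /2⌋) (+-identityʳ r) ⟩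
  -- Symmetry makes the two lower indices consecutive, as Pascal's rule requires.
  r C ⌈ r /2⌉ + r C suc ⌊ r /2⌋           ≡⟨ cong (_+ r C suc ⌊ r /2⌋) (C-halves r) ⟨
  r C ⌊ r /2⌋ + r C suc ⌊ r /2⌋           ≡⟨ nCk+nC[k+1]≡[n+1]C[k+1] r ⌊ r /2⌋ ⟩
  suc r C suc ⌊ r /2⌋                     ∎
  where open ≡-Reasoning
surv-suc (suc r) (suc s) = begin
  surv r (1 + s) + surv r (3 + s)
    ≡⟨ cong₂ _+_ (surv-suc r s) (surv-suc r (2 + s)) ⟩
  surv r s + c + (surv r (2 + s) + r C ⌊ suc (r + (2 + s)) /2⌋)
    ≡⟨ cong (λ a → surv r s + c + (surv r (2 + s) + r C ⌊ suc a /2⌋)) (eq₁ r s) ⟩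
  surv r s + c + (surv r (2 + s) + c′)
    ≡⟨ eq₂ (surv r s) c (surv r (2 + s)) c′ ⟩
  surv r s + surv r (2 + s) + (c + c′)
    ≡⟨ cong (surv r s + surv r (2 + s) +_) (nCk+nC[k+1]≡[n+1]C[k+1] r ⌊ suc (r + s) /2⌋) ⟩
  surv r s + surv r (2 + s) + suc r C suc ⌊ suc (r + s) /2⌋
    ≡⟨ cong (λ a → surv r s + surv r (2 + s) + suc r C suc ⌊ a /2⌋) (+-suc r s) ⟨
  surv r s + surv r (2 + s) + suc r C suc ⌊ r + suc s /2⌋ ∎
  where
  open ≡-Reasoning
  c = r C ⌊ suc (r + s) /2⌋
  c′ = r C suc ⌊ suc (r + s) /2⌋
  eq₁ : ∀ r s → r + (2 + s) ≡ 2 + (r + s)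
  eq₁ = solve-∀
  eq₂ : ∀ a b c d → a + b + (c + d) ≡ a + c + (b + d)
  eq₂ = solve-∀

surv≤surv-suc : ∀ r s → surv r s ≤ surv r (suc s)
surv≤surv-suc r s = subst (surv r s ≤_) (sym (surv-suc r s)) (m≤m+n _ _)

-- By concavity the increments in the height decrease, and the first of them is `surv r 1`.
surv-suc-≤ : ∀ r s → surv r (suc s) ≤ surv r s + surv r 1
surv-suc-≤ r zero    = ≤-refl
surv-suc-≤ r (suc s) = +-cancelʳ-≤ (surv r s) _ _ (begin
  surv r (2 + s) + surv r s                        ≤⟨ m≤n+m _ (hits r (1 + s)) ⟩
  hits r (1 + s) + (surv r (2 + s) + surv r s)     ≡⟨ hits-surv r s ⟩
  2 * surv r (1 + s)                               ≡⟨ cong (surv r (1 + s) +_) (+-identityʳ _) ⟩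
  surv r (1 + s) + surv r (1 + s)                  ≤⟨ +-monoʳ-≤ (surv r (1 + s)) (surv-suc-≤ r s) ⟩
  surv r (1 + s) + (surv r s + surv r 1)           ≡⟨ eq (surv r (1 + s)) (surv r s) (surv r 1) ⟩
  surv r (1 + s) + surv r 1 + surv r s             ∎)
  where
  open ≤-Reasoning
  eq : ∀ a b c → a + (b + c) ≡ a + c + b
  eq = solve-∀

surv≤*surv1 : ∀ r s → surv r s ≤ s * surv r 1
surv≤*surv1 r zero    = z≤n
surv≤*surv1 r (suc s) = begin
  surv r (suc s)          ≤⟨ surv-suc-≤ r s ⟩
  surv r s + surv r 1     ≤⟨ +-monoˡ-≤ (surv r 1) (surv≤*surv1 r s) ⟩
  s * surv r 1 + surv r 1 ≡⟨ +-comm (s * surv r 1) (surv r 1) ⟩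
  suc s * surv r 1        ∎
  where open ≤-Reasoning

-- Abel summation over the starting height

Σ₁ : (ℕ → ℕ) → ℕ → ℕ
Σ₁ f zero    = 0
Σ₁ f (suc T) = Σ₁ f T + f (suc T)

Σ₁-mono-≤ : ∀ {f g} T → (∀ t → f t ≤ g t) → Σ₁ f T ≤ Σ₁ g T
Σ₁-mono-≤ zero    f≤g = z≤n
Σ₁-mono-≤ (suc T) f≤g = +-mono-≤ (Σ₁-mono-≤ T f≤g) (f≤g (suc T))

Σ₁-*ʳ : ∀ f c T → Σ₁ (λ t → f t * c) T ≡ Σ₁ f T * c
Σ₁-*ʳ f c zero    = refl
Σ₁-*ʳ f c (suc T) = trans (cong (_+ f (suc T) * c) (Σ₁-*ʳ f c T)) (sym (*-distribʳ-+ c (Σ₁ f T) (f (suc T))))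

Σ₁-+ : ∀ f g T → Σ₁ (λ t → f t + g t) T ≡ Σ₁ f T + Σ₁ g T
Σ₁-+ f g zero    = refl
Σ₁-+ f g (suc T) = trans (cong (_+ (f (suc T) + g (suc T))) (Σ₁-+ f g T)) (eq (Σ₁ f T) (Σ₁ g T) (f (suc T)) (g (suc T)))
  where
  eq : ∀ a b c d → a + b + (c + d) ≡ a + c + (b + d)
  eq = solve-∀

term≤Σ₁ : ∀ f {t T} → 1 ≤ t → t ≤ T → f t ≤ Σ₁ f T
term≤Σ₁ f {T = zero}    1≤t t≤T = contradiction (≤-trans 1≤t t≤T) λ ()
term≤Σ₁ f {t} {suc T} 1≤t t≤T with m≤n⇒m<n∨m≡n t≤T
... | inj₁ (s≤s t≤T′) = ≤-trans (term≤Σ₁ f 1≤t t≤T′) (m≤m+n _ _)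
... | inj₂ refl       = m≤n+m _ _

-- A sum of negated second differences telescopes to the first increment of `surv u` minus the last.
-- The terms are moved across the equation to avoid subtraction.
Σ₁-hits : ∀ u T → Σ₁ (hits u) T + surv u (suc T) ≡ surv u T + surv u 1
Σ₁-hits u zero    = refl
Σ₁-hits u (suc T) = +-cancelʳ-≡ (surv u (suc T) + surv u T) _ _ (begin
  S + h + s₂ + (s₁ + s₀)   ≡⟨ eq₁ S h s₀ s₁ s₂ ⟩
  (S + s₁) + (h + (s₂ + s₀))       ≡⟨ cong₂ _+_ (Σ₁-hits u T) (hits-surv u T) ⟩
  s₀ + surv u 1 + 2 * s₁   ≡⟨ eq₂ s₀ s₁ (surv u 1) ⟩
  s₁ + surv u 1 + (s₁ + s₀) ∎)
  where
  open ≡-Reasoning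
  S = Σ₁ (hits u) T
  h = hits u (suc T)
  s₀ = surv u T
  s₁ = surv u (1 + T)
  s₂ = surv u (2 + T)
  eq₁ : ∀ S h s₀ s₁ s₂ → S + h + s₂ + (s₁ + s₀) ≡ (S + s₁) + (h + (s₂ + s₀))
  eq₁ = solve-∀
  eq₂ : ∀ s₀ s₁ c → s₀ + c + 2 * s₁ ≡ s₁ + c + (s₁ + s₀)
  eq₂ = solve-∀

Σ₁-hits-≤ : ∀ u T → Σ₁ (hits u) T ≤ surv u 1
Σ₁-hits-≤ u T = +-cancelʳ-≤ (surv u T) _ _ (begin
  Σ₁ (hits u) T + surv u T       ≤⟨ +-monoʳ-≤ _ (surv≤surv-suc u T) ⟩
  Σ₁ (hits u) T + surv u (suc T) ≡⟨ Σ₁-hits u T ⟩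
  surv u T + surv u 1            ≡⟨ +-comm (surv u T) (surv u 1) ⟩
  surv u 1 + surv u T            ∎)
  where open ≤-Reasoning

-- Summation by parts against the weight t: what remains of the second differences is the boundary
-- term (T + 1) s(T) - T s(T + 1), where s is `surv u`.
Σ₁-hits*t : ∀ u T → Σ₁ (λ t → hits u t * t) T + T * surv u (suc T) ≡ suc T * surv u T
Σ₁-hits*t u zero    = refl
Σ₁-hits*t u (suc T) = +-cancelʳ-≡ (T * s₁ + suc T * s₀) _ _ (begin
  S + h * suc T + suc T * s₂ + (T * s₁ + suc T * s₀)   ≡⟨ eq₁ S h s₀ s₁ s₂ T ⟩
  (S + T * s₁) + suc T * (h + (s₂ + s₀))               ≡⟨ cong₂ (λ a b → a + suc T * b) (Σ₁-hits*t u T) (hits-surv u T) ⟩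
  suc T * s₀ + suc T * (2 * s₁)                        ≡⟨ eq₂ s₀ s₁ T ⟩
  suc (suc T) * s₁ + (T * s₁ + suc T * s₀)             ∎)
  where
  open ≡-Reasoning
  S = Σ₁ (λ t → hits u t * t) T
  h = hits u (suc T)
  s₀ = surv u T
  s₁ = surv u (1 + T)
  s₂ = surv u (2 + T)
  eq₁ : ∀ S h s₀ s₁ s₂ T → S + h * suc T + suc T * s₂ + (T * s₁ + suc T * s₀) ≡ (S + T * s₁) + suc T * (h + (s₂ + s₀))
  eq₁ = solve-∀
  eq₂ : ∀ s₀ s₁ T → suc T * s₀ + suc T * (2 * s₁) ≡ suc (suc T) * s₁ + (T * s₁ + suc T * s₀)
  eq₂ = solve-∀

Σ₁-hits*t-≤ : ∀ u T → Σ₁ (λ t → hits u t * t) T ≤ 2 ^ u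
Σ₁-hits*t-≤ u T = ≤-trans (+-cancelʳ-≤ (T * surv u T) _ _ (begin
  S + T * surv u T               ≤⟨ +-monoʳ-≤ S (*-monoʳ-≤ T (surv≤surv-suc u T)) ⟩
  S + T * surv u (suc T)         ≡⟨ Σ₁-hits*t u T ⟩
  suc T * surv u T               ∎)) (surv≤2^ u T)
  where
  open ≤-Reasoning
  S = Σ₁ (λ t → hits u t * t) T

-- Bounds on the central binomial coefficient

k*nCk : ∀ n k → suc k * (suc n C suc k) ≡ suc n * (n C k)
k*nCk n       zero    = trans (+-identityʳ _) (trans (nC1≡n (suc n)) (sym (*-identityʳ (suc n))))
k*nCk zero    (suc k) = trans (cong (suc (suc k) *_) (k>n⇒nCk≡0 {1} {suc (suc k)} (s≤s (s≤s z≤n))))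
                          (trans (*-zeroʳ (suc (suc k))) (sym (cong (1 *_) (k>n⇒nCk≡0 {0} {suc k} (s≤s z≤n)))))
k*nCk (suc n) (suc k) = begin
  suc (suc k) * (suc (suc n) C suc (suc k))
    ≡⟨ cong (suc (suc k) *_) (nCk+nC[k+1]≡[n+1]C[k+1] (suc n) (suc k)) ⟨
  suc (suc k) * (c + (suc n C suc (suc k)))
    ≡⟨ eq₁ k c (suc n C suc (suc k)) ⟩
  c + suc k * c + suc (suc k) * (suc n C suc (suc k))
    ≡⟨ cong₂ (λ a b → c + a + b) (k*nCk n k) (k*nCk n (suc k)) ⟩
  c + suc n * (n C k) + suc n * (n C suc k)
    ≡⟨ eq₂ c n (n C k) (n C suc k) ⟩
  c + suc n * (n C k + n C suc k)
    ≡⟨ cong (λ a → c + suc n * a) (nCk+nC[k+1]≡[n+1]C[k+1] n k) ⟩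
  suc (suc n) * c ∎
  where
  open ≡-Reasoning
  c = suc n C suc k
  eq₁ : ∀ k c d → suc (suc k) * (c + d) ≡ c + suc k * c + suc (suc k) * d
  eq₁ = solve-∀
  eq₂ : ∀ c n a b → c + suc n * a + suc n * b ≡ c + suc n * (a + b)
  eq₂ = solve-∀

surv1≡C : ∀ r → surv r 1 ≡ r C ⌈ r /2⌉
surv1≡C r = trans (surv-suc r 0) (cong (λ a → r C ⌊ suc a /2⌋) (+-identityʳ r))

⌈m+m/2⌉≡m : ∀ m → ⌈ m + m /2⌉ ≡ m
⌈m+m/2⌉≡m zero    = refl
⌈m+m/2⌉≡m (suc m) = trans (cong (λ a → ⌊ suc (suc a) /2⌋) (+-suc m m)) (cong suc (⌈m+m/2⌉≡m m))

surv1-even : ∀ m → surv (m + m) 1 ≡ (m + m) C m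
surv1-even m = trans (surv1≡C (m + m)) (cong ((m + m) C_) (⌈m+m/2⌉≡m m))

surv1-odd : ∀ m → surv (suc (m + m)) 1 ≡ suc (m + m) C suc m
surv1-odd m = trans (surv1≡C (suc (m + m))) (cong (λ a → suc (m + m) C suc a) (sym (n≡⌊n+n/2⌋ m)))

-- Pascal's rule splits the central coefficient into two summands that are equal by symmetry.
suc-C : ∀ m → (suc m + suc m) C suc m ≡ 2 * (suc (m + m) C suc m)
suc-C m = begin
  (suc m + suc m) C suc m                     ≡⟨ cong (λ a → suc a C suc m) (+-suc m m) ⟩
  suc (suc (m + m)) C suc m                   ≡⟨ nCk+nC[k+1]≡[n+1]C[k+1] (suc (m + m)) m ⟨
  suc (m + m) C m + suc (m + m) C suc m       ≡⟨ cong (_+ suc (m + m) C suc m) (nCk≡nC[n∸k] (m≤n⇒m≤1+n (m≤m+n m m))) ⟩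
  suc (m + m) C (suc (m + m) ∸ m) + c         ≡⟨ cong (λ a → suc (m + m) C a + c) (trans (cong (_∸ m) (sym (+-suc m m))) (m+n∸m≡n m (suc m))) ⟩
  c + c                                       ≡⟨ cong (c +_) (+-identityʳ c) ⟨
  2 * c                                       ∎
  where
  open ≡-Reasoning
  c = suc (m + m) C suc m

4^suc-double : ∀ m → 4 ^ (suc m + suc m) ≡ 16 * 4 ^ (m + m)
4^suc-double m = trans (cong (λ a → 4 * 4 ^ a) (+-suc m m)) (eq (4 ^ (m + m)))
  where
  eq : ∀ a → 4 * (4 * a) ≡ 16 * a
  eq = solve-∀

-- Induction on the ratio of consecutive central coefficients, 2(2m + 1)/(m + 1); the factor (m +
-- 1)² is multiplied in to stay within the natural numbers.
centralC² : ∀ m → let c = (m + m) C m in c * c * suc (m + m) ≤ 4 ^ (m + m)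
centralC² zero    = ≤-refl
centralC² (suc m) = *-cancelˡ-≤ (suc m * suc m) (begin
  suc m * suc m * (c′ * c′ * suc (suc m + suc m))
    ≡⟨ cong (λ a → suc m * suc m * (a * a * suc (suc m + suc m))) (suc-C m) ⟩
  suc m * suc m * (2 * d * (2 * d) * suc (suc m + suc m))
    ≡⟨ eq₁ m d ⟩
  4 * (suc m * d * (suc m * d)) * (m + m + 3)
    ≡⟨ cong (λ a → 4 * (a * a) * (m + m + 3)) (k*nCk (m + m) m) ⟩
  4 * (suc (m + m) * c * (suc (m + m) * c)) * (m + m + 3)
    ≡⟨ eq₂ m c ⟩
  c * c * suc (m + m) * (4 * (suc (m + m) * (m + m + 3)))
    -- The slack comes from (2m + 1)(2m + 3) = 4(m + 1)² - 1, multiplied by 4.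
    ≤⟨ *-mono-≤ (centralC² m) (≤-trans (m≤m+n _ 4) (≤-reflexive (eq₃ m))) ⟩
  4 ^ (m + m) * (suc m * suc m * 16)
    ≡⟨ eq₄ (4 ^ (m + m)) (suc m * suc m) ⟩
  suc m * suc m * (16 * 4 ^ (m + m))
    ≡⟨ cong (suc m * suc m *_) (4^suc-double m) ⟨
  suc m * suc m * 4 ^ (suc m + suc m) ∎)
  where
  open ≤-Reasoning
  c = (m + m) C m
  c′ = (suc m + suc m) C suc m
  d = suc (m + m) C suc m
  eq₁ : ∀ m d → suc m * suc m * (2 * d * (2 * d) * suc (suc m + suc m)) ≡ 4 * (suc m * d * (suc m * d)) * (m + m + 3)
  eq₁ = solve-∀
  eq₂ : ∀ m c → 4 * (suc (m + m) * c * (suc (m + m) * c)) * (m + m + 3) ≡ c * c * suc (m + m) * (4 * (suc (m + m) * (m + m + 3)))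
  eq₂ = solve-∀
  eq₃ : ∀ m → 4 * (suc (m + m) * (m + m + 3)) + 4 ≡ suc m * suc m * 16
  eq₃ = solve-∀
  eq₄ : ∀ a b → a * (b * 16) ≡ b * (16 * a)
  eq₄ = solve-∀

even⊎odd : ∀ r → ∃ λ m → r ≡ m + m ⊎ r ≡ suc (m + m)
even⊎odd zero = 0 , inj₁ refl
even⊎odd (suc r) with even⊎odd r
... | m , inj₁ eq = m , inj₂ (cong suc eq)
... | m , inj₂ eq = suc m , inj₁ (cong suc (trans eq (sym (+-suc m m))))

-- For odd `r` the coefficient is half of the next central one, so the even case at `suc m` applies.
surv1² : ∀ r → surv r 1 * surv r 1 * suc r ≤ 4 ^ r
surv1² r with even⊎odd r
... | m , inj₁ refl rewrite surv1-even m = centralC² m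
... | m , inj₂ refl rewrite surv1-odd m = *-cancelˡ-≤ 4 (begin
  4 * (d * d * suc (suc (m + m)))          ≡⟨ eq m d ⟩
  2 * d * (2 * d) * (suc m + suc m)        ≡⟨ cong (λ a → a * a * (suc m + suc m)) (suc-C m) ⟨
  c′ * c′ * (suc m + suc m)                ≤⟨ *-monoʳ-≤ (c′ * c′) (n≤1+n (suc m + suc m)) ⟩
  c′ * c′ * suc (suc m + suc m)            ≤⟨ centralC² (suc m) ⟩
  4 ^ (suc m + suc m)                      ≡⟨ cong (λ a → 4 ^ suc a) (+-suc m m) ⟩
  4 * 4 ^ suc (m + m)                      ∎)
  where
  open ≤-Reasoning
  d = suc (m + m) C suc m
  c′ = (suc m + suc m) C suc m
  eq : ∀ m d → 4 * (d * d * suc (suc (m + m))) ≡ 2 * d * (2 * d) * (suc m + suc m)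
  eq = solve-∀

-- The square bound for the sum over levels

4^≡2^*2^ : ∀ n → 4 ^ n ≡ 2 ^ n * 2 ^ n
4^≡2^*2^ n = trans (^-*-assoc 2 2 n) (trans (cong (λ k → 2 ^ (n + k)) (+-identityʳ n)) (^-distribˡ-+-* 2 n n))

square-mono : ∀ {a b} → a ≤ b → a * a ≤ b * b
square-mono a≤b = *-mono-≤ a≤b a≤b

-- Here `v` is the length of the longer part of the walk, which supplies the square-root saving, and
-- `u` that of the shorter part, which is counted trivially by a power of 2.
weighted-square-bound : ∀ {n b} u v c → u + suc v ≡ n → n ≤ 2 * suc v →
    b ≤ 2 ^ u * c → c * c * suc v ≤ 4 ^ v → b * b * n < 4 ^ n
weighted-square-bound {n} {b} u v c refl n≤ b≤ c≤ = begin-strict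
  b * b * n                                  ≤⟨ *-mono-≤ (square-mono b≤) n≤ ⟩
  2 ^ u * c * (2 ^ u * c) * (2 * suc v)      ≡⟨ eq₁ (2 ^ u) c (suc v) ⟩
  2 * (2 ^ u * 2 ^ u * (c * c * suc v))      ≡⟨ cong (λ a → 2 * (a * (c * c * suc v))) (4^≡2^*2^ u) ⟨
  2 * (4 ^ u * (c * c * suc v))              ≤⟨ *-monoʳ-≤ 2 (*-monoʳ-≤ (4 ^ u) c≤) ⟩
  2 * (4 ^ u * 4 ^ v)                        ≡⟨ cong (2 *_) (^-distribˡ-+-* 4 u v) ⟨
  -- The lengths `u` and `v` omit one step, bit i. It gives a factor 4 against the 2 lost in n ≤ 2(v
  -- + 1), so the bound is strict.
  2 * 4 ^ (u + v)                            <⟨ *-monoˡ-< (4 ^ (u + v)) ⦃ m^n≢0 4 (u + v) ⦄ {2} {4} (s≤s (s≤s (s≤s z≤n))) ⟩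
  4 * 4 ^ (u + v)                            ≡⟨ cong (4 ^_) (+-suc u v) ⟨
  4 ^ (u + suc v)                            ∎
  where
  open ≤-Reasoning
  eq₁ : ∀ a c v → a * c * (a * c) * (2 * v) ≡ 2 * (a * a * (c * c * v))
  eq₁ = solve-∀

Σ₁-hits*surv² : ∀ {n} u r → u + suc r ≡ n →
   let b = Σ₁ (λ t → hits u t * surv r t) n in b * b * n < 4 ^ n
Σ₁-hits*surv² {n} u r eq with ≤-total u (suc r)
... | inj₁ u≤1+r = weighted-square-bound u r (surv r 1) eq
  (begin
    n              ≡⟨ eq ⟨
    u + suc r      ≤⟨ +-monoˡ-≤ (suc r) u≤1+r ⟩
    suc r + suc r  ≡⟨ cong (suc r +_) (+-identityʳ (suc r)) ⟨
    2 * suc r      ∎)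
  (begin
    Σ₁ (λ t → hits u t * surv r t) n        ≤⟨ Σ₁-mono-≤ n (λ t → *-monoʳ-≤ (hits u t) (surv≤*surv1 r t)) ⟩
    Σ₁ (λ t → hits u t * (t * surv r 1)) n  ≤⟨ Σ₁-mono-≤ n (λ t → ≤-reflexive (sym (*-assoc (hits u t) t (surv r 1)))) ⟩
    Σ₁ (λ t → hits u t * t * surv r 1) n    ≡⟨ Σ₁-*ʳ (λ t → hits u t * t) (surv r 1) n ⟩
    Σ₁ (λ t → hits u t * t) n * surv r 1    ≤⟨ *-monoˡ-≤ (surv r 1) (Σ₁-hits*t-≤ u n) ⟩
    2 ^ u * surv r 1                        ∎)
  (surv1² r)
  where open ≤-Reasoning
-- The roles are exchanged: the part before bit i is the longer one, and its saving comes from the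
-- total number of hits.
... | inj₂ 1+r≤u = weighted-square-bound r u (surv u 1) (trans (trans (+-suc r u) (+-comm (suc r) u)) eq)
  (begin
    n              ≡⟨ eq ⟨
    u + suc r      ≤⟨ +-monoʳ-≤ u 1+r≤u ⟩
    u + u          ≤⟨ +-mono-≤ (n≤1+n u) (n≤1+n u) ⟩
    suc u + suc u  ≡⟨ cong (suc u +_) (+-identityʳ (suc u)) ⟨
    2 * suc u      ∎)
  (begin
    Σ₁ (λ t → hits u t * surv r t) n        ≤⟨ Σ₁-mono-≤ n (λ t → *-monoʳ-≤ (hits u t) (surv≤2^ r t)) ⟩
    Σ₁ (λ t → hits u t * 2 ^ r) n           ≡⟨ Σ₁-*ʳ (hits u) (2 ^ r) n ⟩
    Σ₁ (hits u) n * 2 ^ r                   ≤⟨ *-monoˡ-≤ (2 ^ r) (Σ₁-hits-≤ u n) ⟩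
    surv u 1 * 2 ^ r                        ≡⟨ *-comm (surv u 1) (2 ^ r) ⟩
    2 ^ r * surv u 1                        ∎)
  (surv1² u)
  where open ≤-Reasoning

-- Bit strings as walks, and the shape of a finished marking

-- Indicators: stays s x says that the walk x from s stays positive, falls i T s x
-- that it reaches 0 for the first time at bit i and that the remaining bits,
-- restarted from T, stay positive.
stays : ℕ → Bits n → ℕ
stays zero    x           = 0
stays (suc s) []          = 1
stays (suc s) (true  ∷ x) = stays (2 + s) x
stays (suc s) (false ∷ x) = stays s x

falls : Fin n → ℕ → ℕ → Bits n → ℕ
falls i       T zero          x           = 0
falls zero    T (suc s)       (true  ∷ x) = 0
falls zero    T (suc zero)    (false ∷ x) = stays T x
falls zero    T (suc (suc s)) (false ∷ x) = 0
falls (suc i) T (suc s)       (true  ∷ x) = falls i T (2 + s) x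
falls (suc i) T (suc s)       (false ∷ x) = falls i T s x

-- Balanced d x M: between unmarked bits, the marked ones are matched brackets
-- (1 opens, 0 closes), given d brackets already open on the left.
data Balanced : ℕ → Bits n → Subset n → Set where
  []   : Balanced 0 [] []
  rise : ∀ {d} {x : Bits n} {M} → Balanced (suc d) x M → Balanced d (true ∷ x) (inside ∷ M)
  fall : ∀ {d} {x : Bits n} {M} → Balanced d x M → Balanced (suc d) (false ∷ x) (inside ∷ M)
  free : ∀ b {x : Bits n} {M} → Balanced 0 x M → Balanced 0 (b ∷ x) (outside ∷ M)

#free₀ : Bits n → Subset n → ℕ
#free₀ []          []            = 0
#free₀ (b     ∷ x) (inside  ∷ M) = #free₀ x M
#free₀ (true  ∷ x) (outside ∷ M) = #free₀ x M
#free₀ (false ∷ x) (outside ∷ M) = suc (#free₀ x M)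

#free₁ : Bits n → Subset n → ℕ
#free₁ []          []            = 0
#free₁ (b     ∷ x) (inside  ∷ M) = #free₁ x M
#free₁ (true  ∷ x) (outside ∷ M) = suc (#free₁ x M)
#free₁ (false ∷ x) (outside ∷ M) = #free₁ x M

-- The unmarked bits read 0...01...1. At the first unmarked 1 it remains to say that no unmarked 0
-- follows, which `free₁` expresses by a count.
data Sorted : Bits n → Subset n → Set where
  []     : Sorted [] []
  skip   : ∀ b {x : Bits n} {M} → Sorted x M → Sorted (b ∷ x) (inside ∷ M)
  free₀  : ∀ {x : Bits n} {M} → Sorted x M → Sorted (false ∷ x) (outside ∷ M)
  free₁  : ∀ {x : Bits n} {M} → #free₀ x M ≡ 0 → Sorted (true ∷ x) (outside ∷ M)

-- Invariants of the marking process

balanced-⊥ : (x : Bits n) → Balanced 0 x ⊥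
balanced-⊥ []      = []
balanced-⊥ (b ∷ x) = free b (balanced-⊥ x)

-- Serves `balanced-mark`: once the 1 of a new pair opens a bracket, the bits after it are read one
-- level deeper until the 0 at `q` closes that bracket.
balanced-close : ∀ {d} {x : Bits n} {M} → Balanced d x M → ∀ q → q ∉ M →
  (∀ r → r <ᶠ q → r ∈ M) → lookup x q ≡ false → Balanced (suc d) x (M ∪ ⁅ q ⁆)
balanced-close (rise bal) zero q∉ below eq = contradiction here q∉
balanced-close (fall bal) zero q∉ below eq = contradiction here q∉
balanced-close (free false {M = M} bal) zero q∉ below eq =
  fall (subst (Balanced 0 _) (sym (∪-identityʳ M)) bal)
balanced-close (rise bal) (suc q) q∉ below eq =
  rise (balanced-close bal q (q∉ ∘ there) (λ r r<q → drop-there (below (suc r) (s≤s r<q))) eq)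
balanced-close (fall bal) (suc q) q∉ below eq =
  fall (balanced-close bal q (q∉ ∘ there) (λ r r<q → drop-there (below (suc r) (s≤s r<q))) eq)
balanced-close (free b bal) (suc q) q∉ below eq = case below zero (s≤s z≤n) of λ ()

markable-tail : ∀ b {s} (x : Bits n) {M p q} →
  Markable (b ∷ x) (s ∷ M) (suc p) (suc q) → Markable x M p q
markable-tail b x (s≤s p<q , p∉ , q∉ , between , xp , xq) =
  p<q , p∉ ∘ there , q∉ ∘ there ,
  (λ r p<r r<q → drop-there (between (suc r) (s≤s p<r) (s≤s r<q))) , xp , xq

-- Unmarked bits occur only at depth 0, so the marked bits between `p` and `q` are matched among
-- themselves, and the new pair encloses them.
balanced-mark : ∀ {d} {x : Bits n} {M} p q → Balanced d x M → Markable x M p q →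
  Balanced d x (M ∪ (⁅ p ⁆ ∪ ⁅ q ⁆))
balanced-mark (suc p) (suc q) (rise {x = x} bal) m = rise (balanced-mark p q bal (markable-tail true x m))
balanced-mark (suc p) (suc q) (fall {x = x} bal) m = fall (balanced-mark p q bal (markable-tail false x m))
balanced-mark (suc p) (suc q) (free b {x} bal) m = free b (balanced-mark p q bal (markable-tail b x m))
balanced-mark zero (suc q) (rise bal) (_ , p∉ , _) = contradiction here p∉
balanced-mark zero (suc q) (fall bal) (_ , p∉ , _) = contradiction here p∉
balanced-mark zero (suc q) (free true {M = M} bal) (_ , _ , q∉ , between , _ , xq) =
  rise (subst (λ N → Balanced 1 _ (M ∪ N)) (sym (∪-identityˡ ⁅ q ⁆))
    (balanced-close bal q (q∉ ∘ there) (λ r r<q → drop-there (between (suc r) (s≤s z≤n) (s≤s r<q))) xq))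

balanced-star : ∀ {x : Bits n} {M M′} → Star (Step x) M M′ → Balanced 0 x M → Balanced 0 x M′
balanced-star ε                bal = bal
balanced-star (mark p q m ◅ s) bal = balanced-star s (balanced-mark p q bal m)

markable-suc : ∀ b {s} (x : Bits n) {M p q} →
  Markable x M p q → Markable (b ∷ x) (s ∷ M) (suc p) (suc q)
markable-suc b {s} x {M} {p} {q} (p<q , p∉ , q∉ , between , xp , xq) =
  s≤s p<q , p∉ ∘ drop-there , q∉ ∘ drop-there , between′ , xp , xq
  where
  between′ : ∀ r → suc p <ᶠ r → r <ᶠ suc q → r ∈ s ∷ M
  between′ (suc r) (s≤s p<r) (s≤s r<q) = there (between r p<r r<q)

stuck-tail : ∀ {b s} (x : Bits n) {M} → Stuck (b ∷ x) (s ∷ M) → Stuck x M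
stuck-tail {b = b} x stuck (p , q , m) = stuck (suc p , suc q , markable-suc b x m)

FirstFree₀ : Bits n → Subset n → Fin n → Set
FirstFree₀ x M q = q ∉ M × (∀ r → r <ᶠ q → r ∈ M) × lookup x q ≡ false

markable-head : ∀ (x : Bits n) {M q} → FirstFree₀ x M q → Markable (true ∷ x) (outside ∷ M) zero (suc q)
markable-head {n} x {M} {q} (q∉ , below , xq) = s≤s z≤n , (λ ()) , q∉ ∘ drop-there , between , refl , xq
  where
  between : ∀ r → zero {n} <ᶠ r → r <ᶠ suc q → r ∈ outside ∷ M
  between (suc r) _ (s≤s r<q) = there (below r r<q)

-- If the first unmarked bit were a 1, induction would make the next unmarked bit a 0, and these two
-- could be marked.
firstFree₀ : (x : Bits n) (M : Subset n) → Stuck x M → #free₀ x M ≢ 0 → ∃ (FirstFree₀ x M)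
firstFree₀ []          []            stuck ≢0 = contradiction refl ≢0
firstFree₀ (b ∷ x)     (inside ∷ M)  stuck ≢0 with firstFree₀ x M (stuck-tail x stuck) ≢0
... | q , q∉ , below , xq = suc q , q∉ ∘ drop-there , below′ , xq
  where
  below′ : ∀ r → r <ᶠ suc q → r ∈ inside ∷ M
  below′ zero    _         = here
  below′ (suc r) (s≤s r<q) = there (below r r<q)
firstFree₀ (true ∷ x)  (outside ∷ M) stuck ≢0 with firstFree₀ x M (stuck-tail x stuck) ≢0
... | q , first = contradiction (zero , suc q , markable-head x first) stuck
firstFree₀ (false ∷ x) (outside ∷ M) stuck ≢0 = zero , (λ ()) , (λ _ ()) , refl

stuck⇒sorted : (x : Bits n) (M : Subset n) → Stuck x M → Sorted x M
stuck⇒sorted []          []            stuck = []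
stuck⇒sorted (b ∷ x)     (inside ∷ M)  stuck = skip b (stuck⇒sorted x M (stuck-tail x stuck))
stuck⇒sorted (false ∷ x) (outside ∷ M) stuck = free₀ (stuck⇒sorted x M (stuck-tail x stuck))
stuck⇒sorted (true ∷ x)  (outside ∷ M) stuck with #free₀ x M ≟ⁿ 0
... | yes ≡0 = free₁ ≡0
... | no  ≢0 with firstFree₀ x M (stuck-tail x stuck) ≢0
...   | q , first = contradiction (zero , suc q , markable-head x first) stuck

-- The witness `o` counts the marked 1s. The marked 0s number `o + d`, because they also close the
-- `d` brackets opened on the left.
balanced-counts : ∀ {d} {x : Bits n} {M} → Balanced d x M → ∃ λ o →
  weight x ≡ o + #free₁ x M ×
  n ≡ o + o + d + (#free₀ x M + #free₁ x M) ×
  ∣ ∁ M ∣ ≡ #free₀ x M + #free₁ x M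
balanced-counts [] = 0 , refl , refl , refl
balanced-counts (rise {d = d} {x} {M} bal) with balanced-counts bal
... | o , w , l , u = suc o , cong suc w , trans (cong suc l) (eq o d _) , u
  where
  eq : ∀ o d k → suc (o + o + suc d + k) ≡ suc o + suc o + d + k
  eq = solve-∀
balanced-counts (fall {d = d} bal) with balanced-counts bal
... | o , w , l , u = o , w , trans (cong suc l) (eq o d _) , u
  where
  eq : ∀ o d k → suc (o + o + d + k) ≡ o + o + suc d + k
  eq = solve-∀
balanced-counts (free true {x} {M} bal) with balanced-counts bal
... | o , w , l , u = o , trans (cong suc w) (sym (+-suc o _)) , trans (cong suc l) (eq o (#free₀ x M) (#free₁ x M))
    , trans (cong suc u) (sym (+-suc (#free₀ x M) _))
  where
  eq : ∀ o a b → suc (o + o + 0 + (a + b)) ≡ o + o + 0 + (a + suc b)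
  eq = solve-∀
balanced-counts (free false {x} {M} bal) with balanced-counts bal
... | o , w , l , u = o , w , trans (cong suc l) (eq o (#free₀ x M) (#free₁ x M)) , cong suc u
  where
  eq : ∀ o a b → suc (o + o + 0 + (a + b)) ≡ o + o + 0 + (suc a + b)
  eq = solve-∀

#free₀≤n : (x : Bits n) (M : Subset n) → #free₀ x M ≤ n
#free₀≤n []          []            = z≤n
#free₀≤n (b ∷ x)     (inside ∷ M)  = m≤n⇒m≤1+n (#free₀≤n x M)
#free₀≤n (true ∷ x)  (outside ∷ M) = m≤n⇒m≤1+n (#free₀≤n x M)
#free₀≤n (false ∷ x) (outside ∷ M) = s≤s (#free₀≤n x M)

-- Changed bits are first hitting times

-- A matched pair never takes the walk below its own start, so the total descent is at most the `d`
-- pending closing brackets plus the unmarked zeros.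
balanced⇒stays : ∀ {d s} {x : Bits n} {M} → Balanced d x M → d + #free₀ x M < s → stays s x ≡ 1
balanced⇒stays []               (s≤s lt) = refl
balanced⇒stays (rise bal)       (s≤s lt) = balanced⇒stays bal (s≤s (s≤s lt))
balanced⇒stays (fall bal)       (s≤s lt) = balanced⇒stays bal lt
balanced⇒stays (free true bal)  (s≤s lt) = balanced⇒stays bal (m≤n⇒m≤1+n (s≤s lt))
balanced⇒stays (free false bal) (s≤s lt) = balanced⇒stays bal lt

fill-zero : (x : Bits n) (M : Subset n) → #free₀ x M ≡ 0 → fill M x 0 ≡ x
fill-zero []         []            eq = refl
fill-zero (b ∷ x)    (inside ∷ M)  eq = cong (b ∷_) (fill-zero x M eq)
fill-zero (true ∷ x) (outside ∷ M) eq = cong (true ∷_) (fill-zero x M eq)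

-- The witness t is the rank of bit i among the unmarked zeros.
flip⇒falls : ∀ {d} {x : Bits n} {M} z → Balanced d x M → Sorted x M → z ≤ #free₀ x M →
  ∀ i → lookup (fill M x z) i ≢ lookup x i →
  ∃ λ t → z < t × t ≤ #free₀ x M × (∀ T → #free₀ x M < T + t → falls i T (d + t) x ≡ 1)
flip⇒falls z (rise bal) sorted z≤ zero    neq = contradiction refl neq
flip⇒falls z (fall bal) sorted z≤ zero    neq = contradiction refl neq
flip⇒falls {d = d} z (rise {x = x} bal) (skip _ sorted) z≤ (suc i) neq with flip⇒falls z bal sorted z≤ i neq
... | t@(suc t′) , z<t , t≤ , falling =
  t , z<t , t≤ , λ T lt → subst (λ s → falls (suc i) T s (true ∷ x) ≡ 1) (sym (+-suc d t′))
    (subst (λ s → falls i T (suc s) x ≡ 1) (+-suc d t′) (falling T lt))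
flip⇒falls z (fall bal) (skip _ sorted) z≤ (suc i) neq = flip⇒falls z bal sorted z≤ i neq
-- No unmarked 0 follows an unmarked 1, so `z` is 0 and `fill` changes nothing from here on.
flip⇒falls z (free true {x} {M} bal) (free₁ ≡0) z≤ i neq with refl ← n≤0⇒n≡0 (subst (z ≤_) ≡0 z≤) =
  contradiction (cong (λ y → lookup (true ∷ y) i) (fill-zero x M ≡0)) neq
-- With no zeros left to keep, this unmarked zero is raised. Its rank is 1, and the later unmarked
-- zeros are fewer than `T`.
flip⇒falls zero    (free false {x} {M} bal) (free₀ sorted) z≤ zero neq =
  1 , s≤s z≤n , s≤s z≤n , λ T lt → balanced⇒stays bal (s≤s⁻¹ (subst (suc (#free₀ x M) <_) (+-comm T 1) lt))
flip⇒falls (suc z) (free false bal) (free₀ sorted) z≤ zero neq = contradiction refl neq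
flip⇒falls zero    (free false {x} {M} bal) (free₀ sorted) z≤ (suc i) neq with flip⇒falls 0 bal sorted z≤n i neq
... | t , z<t , t≤ , falling =
  suc t , s≤s z≤n , s≤s t≤ , λ T lt → falling T (s≤s⁻¹ (subst (suc (#free₀ x M) <_) (+-suc T t) lt))
flip⇒falls (suc z) (free false {x} {M} bal) (free₀ sorted) (s≤s z≤) (suc i) neq with flip⇒falls z bal sorted z≤ i neq
... | t , z<t , t≤ , falling =
  suc t , s≤s z<t , s≤s t≤ , λ T lt → falling T (s≤s⁻¹ (subst (suc (#free₀ x M) <_) (+-suc T t) lt))

-- How many unmarked zeros ψ raises

lookup-∷ʳ-inject₁ : ∀ {A : Set} (xs : Vec A n) y i → lookup (xs ∷ʳ y) (inject₁ i) ≡ lookup xs i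
lookup-∷ʳ-inject₁ (x ∷ xs) y zero    = refl
lookup-∷ʳ-inject₁ (x ∷ xs) y (suc i) = lookup-∷ʳ-inject₁ xs y i

-- Here o is the number of marked pairs, and a and b are the numbers of unmarked
-- zeros and ones; z is the number of unmarked zeros left by ψ.
half-raise : ∀ o a b c → c ≤ 1 → let z = (a + b) ∸ ((o + (a + b) + (o + b) + c) / 2 ∸ o) in
  z ≤ a × a ≤ suc (z + z)
half-raise o a b c c≤1 = subst (λ z → z ≤ a × a ≤ suc (z + z)) (sym z≡) (m∸n≤m a h , a≤)
  where
  -- The number of unmarked zeros that are raised; `c` is the rounding term.
  h = (a + c) / 2
  2h≤ : h + h ≤ suc a
  2h≤ = begin
    h + h         ≡⟨ cong (h +_) (+-identityʳ h) ⟨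
    2 * h         ≡⟨ *-comm 2 h ⟩
    h * 2         ≤⟨ m/n*n≤m (a + c) 2 ⟩
    a + c         ≤⟨ +-monoʳ-≤ a c≤1 ⟩
    a + 1         ≡⟨ +-comm a 1 ⟩
    suc a         ∎
    where open ≤-Reasoning
  h≤a : h ≤ a
  -- If a < h then also 1 ≤ h, so a + 2 ≤ 2h, against 2h ≤ a + 1.
  h≤a = ≮⇒≥ λ a<h → <⇒≱ (+-mono-≤ a<h (≤-trans (s≤s z≤n) a<h)) (≤-trans 2h≤ (≤-reflexive (+-comm 1 a)))
  a≤ : a ≤ suc ((a ∸ h) + (a ∸ h))
  a≤ = +-cancelʳ-≤ (h + h) _ _ (begin
    a + (h + h)                              ≤⟨ +-monoʳ-≤ a 2h≤ ⟩
    a + suc a                                ≡⟨ cong (λ k → k + suc k) (m∸n+n≡m h≤a) ⟨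
    (a ∸ h) + h + suc ((a ∸ h) + h)          ≡⟨ eq (a ∸ h) h ⟩
    suc ((a ∸ h) + (a ∸ h)) + (h + h)        ∎)
    where
    open ≤-Reasoning
    eq : ∀ k h → k + h + suc (k + h) ≡ suc (k + k) + (h + h)
    eq = solve-∀
  z≡ : (a + b) ∸ ((o + (a + b) + (o + b) + c) / 2 ∸ o) ≡ a ∸ h
  z≡ = begin
    (a + b) ∸ ((o + (a + b) + (o + b) + c) / 2 ∸ o) ≡⟨ cong (λ e → (a + b) ∸ (e / 2 ∸ o)) (eq o a b c) ⟩
    (a + b) ∸ (((o + b) * 2 + (a + c)) / 2 ∸ o)     ≡⟨ cong (λ e → (a + b) ∸ (e ∸ o)) (+-distrib-/-∣ˡ (a + c) (divides (o + b) refl)) ⟩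
    (a + b) ∸ ((o + b) * 2 / 2 + h ∸ o)             ≡⟨ cong (λ e → (a + b) ∸ (e + h ∸ o)) (m*n/n≡m (o + b) 2) ⟩
    (a + b) ∸ (o + b + h ∸ o)                       ≡⟨ cong (λ e → (a + b) ∸ (e ∸ o)) (+-assoc o b h) ⟩
    (a + b) ∸ (o + (b + h) ∸ o)                     ≡⟨ cong ((a + b) ∸_) (m+n∸m≡n o (b + h)) ⟩
    (a + b) ∸ (b + h)                               ≡⟨ ∸-+-assoc (a + b) b h ⟨
    (a + b) ∸ b ∸ h                                 ≡⟨ cong (_∸ h) (m+n∸n≡m a b) ⟩
    a ∸ h                                           ∎
    where
    open ≡-Reasoning
    eq : ∀ o a b c → o + (a + b) + (o + b) + c ≡ (o + b) * 2 + (a + c)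
    eq = solve-∀

marked-balanced : (x : Bits n) → Balanced 0 x (marked x)
marked-balanced x = balanced-star (proj₁ (proj₂ (runMarking x ⊥ (⊃-wellFounded ⊥)))) (balanced-⊥ x)

marked-sorted : (x : Bits n) → Sorted x (marked x)
marked-sorted x = stuck⇒sorted x _ (proj₂ (proj₂ (runMarking x ⊥ (⊃-wellFounded ⊥))))

-- By `balanced-counts` the chain starts at rank o and ends at o + a + b, while x has weight o + b;
-- with these values the claim is `half-raise`.
chain-raise : ∀ (x : Bits n) c → c ≤ 1 →
  let a = #free₀ x (marked x)
      z = #unmarked x ∸ ((n ∸ bottom x + weight x + c) / 2 ∸ bottom x)
  in z ≤ a × a ≤ suc (z + z)
chain-raise {n} x c c≤1 with balanced-counts (marked-balanced x)
... | o , w , l , u = subst (λ z → z ≤ a × a ≤ suc (z + z)) (sym z≡) (half-raise o a b c c≤1)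
  where
  a = #free₀ x (marked x)
  b = #free₁ x (marked x)
  l′ : n ≡ o * 2 + (a + b)
  l′ = trans l (eq o (a + b))
    where
    eq : ∀ o k → o + o + 0 + k ≡ o * 2 + k
    eq = solve-∀
  bottom≡ : bottom x ≡ o
  bottom≡ = begin
    (n ∸ #unmarked x) / 2       ≡⟨ cong₂ (λ i j → (i ∸ j) / 2) l′ u ⟩
    (o * 2 + (a + b) ∸ (a + b)) / 2 ≡⟨ cong (_/ 2) (m+n∸n≡m (o * 2) (a + b)) ⟩
    o * 2 / 2                   ≡⟨ m*n/n≡m o 2 ⟩
    o                           ∎
    where open ≡-Reasoning
  top≡ : n ∸ bottom x ≡ o + (a + b)
  top≡ = begin
    n ∸ bottom x              ≡⟨ cong₂ _∸_ (trans l′ (eq o (a + b))) bottom≡ ⟩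
    o + (o + (a + b)) ∸ o     ≡⟨ m+n∸m≡n o _ ⟩
    o + (a + b)               ∎
    where
    open ≡-Reasoning
    eq : ∀ o k → o * 2 + k ≡ o + (o + k)
    eq = solve-∀
  z≡ : #unmarked x ∸ ((n ∸ bottom x + weight x + c) / 2 ∸ bottom x) ≡
       (a + b) ∸ ((o + (a + b) + (o + b) + c) / 2 ∸ o)
  z≡ = cong₂ _∸_ u (cong₂ (λ i j → i / 2 ∸ j) (cong₂ (λ i j → i + j + c) top≡ w) bottom≡)

-- Merges the two parity cases of `ψ` into one formula with a rounding term `c`.
ψ-chain : (x : Bits n) → ∃₂ λ c b → c ≤ 1 ×
  ψ x ≡ chain x ((n ∸ bottom x + weight x + c) / 2) ∷ʳ b
ψ-chain {n} x with weight x % 2 ≟ⁿ (n ∸ bottom x) % 2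
... | yes _ = 0 , true , z≤n ,
  cong (λ e → chain x (e / 2) ∷ʳ true) (sym (+-identityʳ (n ∸ bottom x + weight x)))
... | no  _ = 1 , false , ≤-refl , refl

ψ-fill : (x : Bits n) → ∃₂ λ z b → ψ x ≡ fill (marked x) x z ∷ʳ b ×
  z ≤ #free₀ x (marked x) × #free₀ x (marked x) ≤ suc (z + z)
ψ-fill x =
  let c , b , c≤1 , eq = ψ-chain x
  in _ , b , eq , chain-raise x c c≤1

-- A raised zero has rank t > z, so there are at most 2z + 1 < 2t unmarked zeros. Fewer than t of
-- them follow bit i, and the rest of the walk, restarted from t, stays positive.
raised-flip⇒falls : ∀ (x : Bits n) M z b → Balanced 0 x M → Sorted x M →
  z ≤ #free₀ x M → #free₀ x M ≤ suc (z + z) →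
  ∀ i → lookup (fill M x z ∷ʳ b) (inject₁ i) ≢ lookup x i →
  ∃ λ t → 1 ≤ t × t ≤ n × falls i t t x ≡ 1
raised-flip⇒falls x M z b bal sorted z≤ ≤z i neq =
  let t , z<t , t≤ , falling = flip⇒falls z bal sorted z≤ i (neq ∘ trans (lookup-∷ʳ-inject₁ (fill M x z) b i))
      a<t+t = begin-strict
        #free₀ x M       ≤⟨ ≤z ⟩
        suc z + z        <⟨ +-monoʳ-< (suc z) (n<1+n z) ⟩
        suc z + suc z    ≤⟨ +-mono-≤ z<t z<t ⟩
        t + t            ∎
  in t , ≤-trans (s≤s z≤n) z<t , ≤-trans t≤ (#free₀≤n x M) , falling t a<t+t
  where open ≤-Reasoning

ψ-flip⇒falls : (x : Bits n) (i : Fin n) → lookup (ψ x) (inject₁ i) ≢ lookup x i →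
  ∃ λ t → 1 ≤ t × t ≤ n × falls i t t x ≡ 1
ψ-flip⇒falls x i neq =
  let z , b , eq , z≤ , ≤z = ψ-fill x
  in raised-flip⇒falls x (marked x) z b (marked-balanced x) (marked-sorted x) z≤ ≤z i
       (neq ∘ trans (cong (λ y → lookup y (inject₁ i)) eq))

-- Union bound over all bit strings

∑bits : (Bits n → ℕ) → ℕ
∑bits {n} f = sum (map f (allBits n))

sum-map-0 : (xs : List A) → sum (map (λ _ → 0) xs) ≡ 0
sum-map-0 []       = refl
sum-map-0 (x ∷ xs) = sum-map-0 xs

∑bits-suc : (f : Bits (suc n) → ℕ) → ∑bits f ≡ ∑bits (f ∘ (false ∷_)) + ∑bits (f ∘ (true ∷_))
∑bits-suc {n} f = begin
  sum (map f (map (false ∷_) xs ++ map (true ∷_) xs))                 ≡⟨ cong sum (map-++ f (map (false ∷_) xs) _) ⟩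
  sum (map f (map (false ∷_) xs) ++ map f (map (true ∷_) xs))         ≡⟨ sum-++ (map f (map (false ∷_) xs)) _ ⟩
  sum (map f (map (false ∷_) xs)) + sum (map f (map (true ∷_) xs))    ≡⟨ cong₂ (λ u v → sum u + sum v) (map-∘ xs) (map-∘ xs) ⟨
  ∑bits (f ∘ (false ∷_)) + ∑bits (f ∘ (true ∷_))                      ∎
  where
  open ≡-Reasoning
  xs = allBits n

length-allBits : ∀ n → length (allBits n) ≡ 2 ^ n
length-allBits zero    = refl
length-allBits (suc n) = begin
  length (map (false ∷_) xs ++ map (true ∷_) xs)            ≡⟨ length-++ (map (false ∷_) xs) ⟩
  length (map (false ∷_) xs) + length (map (true ∷_) xs)    ≡⟨ cong₂ _+_ (length-map _ xs) (length-map _ xs) ⟩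
  length xs + length xs                                     ≡⟨ cong (λ k → k + k) (length-allBits n) ⟩
  2 ^ n + 2 ^ n                                             ≡⟨ cong (2 ^ n +_) (+-identityʳ (2 ^ n)) ⟨
  2 ^ suc n                                                 ∎
  where
  open ≡-Reasoning
  xs = allBits n

∑bits-stays : ∀ n s → ∑bits {n} (stays s) ≡ surv n s
∑bits-stays n       zero    = sum-map-0 (allBits n)
∑bits-stays zero    (suc s) = refl
∑bits-stays (suc n) (suc s) = trans (∑bits-suc {n} (stays (suc s))) (cong₂ _+_ (∑bits-stays n s) (∑bits-stays n (2 + s)))

-- The bits up to i and the bits after i are constrained independently, so the count factors.
-- Keeping `T` apart from `s` lets the recursion move the start while the restart height stays
-- fixed.
∑bits-falls : ∀ (i : Fin n) T s → ∑bits (falls i T s) ≡ hits (toℕ i) s * surv (n ∸ suc (toℕ i)) T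
∑bits-falls {n}     i       T zero          = sum-map-0 (allBits n)
∑bits-falls {suc n} zero    T (suc zero)    =
  trans (∑bits-suc {n} (falls zero T 1)) (cong₂ _+_ (∑bits-stays n T) (sum-map-0 (allBits n)))
∑bits-falls {suc n} zero    T (suc (suc s)) =
  trans (∑bits-suc {n} (falls zero T (2 + s))) (cong₂ _+_ (sum-map-0 (allBits n)) (sum-map-0 (allBits n)))
∑bits-falls {suc n} (suc i) T (suc s)       = begin
  ∑bits (falls (suc i) T (suc s))                          ≡⟨ ∑bits-suc {n} (falls (suc i) T (suc s)) ⟩
  ∑bits (falls i T s) + ∑bits (falls i T (2 + s))          ≡⟨ cong₂ _+_ (∑bits-falls i T s) (∑bits-falls i T (2 + s)) ⟩
  hits (toℕ i) s * c + hits (toℕ i) (2 + s) * c            ≡⟨ *-distribʳ-+ c (hits (toℕ i) s) _ ⟨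
  (hits (toℕ i) s + hits (toℕ i) (2 + s)) * c              ∎
  where
  open ≡-Reasoning
  c = surv (n ∸ suc (toℕ i)) T

Σ₁-0 : ∀ T → Σ₁ (λ _ → 0) T ≡ 0
Σ₁-0 zero    = refl
Σ₁-0 (suc T) = trans (+-identityʳ _) (Σ₁-0 T)

Σ₁-cong : ∀ {f g} T → (∀ t → f t ≡ g t) → Σ₁ f T ≡ Σ₁ g T
Σ₁-cong zero    f≡g = refl
Σ₁-cong (suc T) f≡g = cong₂ _+_ (Σ₁-cong T f≡g) (f≡g (suc T))

sum-map-Σ₁ : ∀ (h : ℕ → A → ℕ) T xs →
  sum (map (λ x → Σ₁ (λ t → h t x) T) xs) ≡ Σ₁ (λ t → sum (map (h t) xs)) T
sum-map-Σ₁ h T []       = sym (Σ₁-0 T)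
sum-map-Σ₁ h T (x ∷ xs) = trans (cong (_ +_) (sum-map-Σ₁ h T xs)) (sym (Σ₁-+ (λ t → h t x) _ T))

-- Every element outside the event is paid for by its own summand of `g`.
length≤filter+sum : ∀ {P : Pred A 0ℓ} (P? : Decidable P) (g : A → ℕ) → (∀ x → ¬ P x → 1 ≤ g x) →
  ∀ xs → length xs ≤ length (filter P? xs) + sum (map g xs)
length≤filter+sum P? g 1≤g []       = z≤n
length≤filter+sum P? g 1≤g (x ∷ xs) with P? x
... | yes _  = s≤s (≤-trans (length≤filter+sum P? g 1≤g xs) (+-monoʳ-≤ (length (filter P? xs)) (m≤n+m _ (g x))))
... | no ¬px = begin
  1 + length xs              ≤⟨ +-mono-≤ (1≤g x ¬px) (length≤filter+sum P? g 1≤g xs) ⟩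
  g x + (k + sum (map g xs)) ≡⟨ eq (g x) k _ ⟩
  k + (g x + sum (map g xs)) ∎
  where
  open ≤-Reasoning
  k = length (filter P? xs)
  eq : ∀ a b c → a + (b + c) ≡ b + (a + c)
  eq = solve-∀

-- Clears denominators: 1 - p is (D - G)/D, and the squared inequality is multiplied by D².
>1-intro : ∀ G D n .{{_ : NonZero D}} → G ≤ D → (D ∸ G) * (D ∸ G) * n < D * D →
  (ℤ.+ G /ℚ D) >1- 1ℚᵘ /√ n
>1-intro G D@(suc d) n G≤D lt = inj₂ (ℚ.<-respˡ-≃ (ℚ.*-congʳ {ℤ.+ n /ℚ 1} (ℚ.*-cong (ℚ.≃-sym 1-p≃) (ℚ.≃-sym 1-p≃))) (*<* goal))
  where
  b = D ∸ G
  1-p≃ : 1ℚᵘ -ℚ (ℤ.+ G /ℚ D) ≃ (ℤ.+ b /ℚ D)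
  1-p≃ = *≡* (begin
    (ℤ.+ 1 ℤ.* ℤ.+ D ℤ.+ ℤ.- ℤ.+ G ℤ.* ℤ.+ 1) ℤ.* ℤ.+ D ≡⟨ cong₂ (λ u v → (u ℤ.+ v) ℤ.* ℤ.+ D) (ℤ.*-identityˡ (ℤ.+ D)) (ℤ.*-identityʳ (ℤ.- ℤ.+ G)) ⟩
    (ℤ.+ D ℤ.- ℤ.+ G) ℤ.* ℤ.+ D ≡⟨ cong (ℤ._* ℤ.+ D) (trans (ℤ.m-n≡m⊖n D G) (ℤ.⊖-≥ G≤D)) ⟩
    ℤ.+ b ℤ.* ℤ.+ D           ≡⟨ cong (λ e → ℤ.+ b ℤ.* ℤ.+ e) (*-identityˡ D) ⟨
    ℤ.+ b ℤ.* ℤ.+ (1 * D)     ∎)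
    where open ≡-Reasoning
  goal : (ℤ.+ b ℤ.* ℤ.+ b ℤ.* ℤ.+ n) ℤ.* ℤ.+ 1 ℤ.< ℤ.+ 1 ℤ.* ℤ.+ (D * D * 1)
  goal = subst₂ ℤ._<_ (sym lhs≡) (sym rhs≡) (+<+ lt)
    where
    lhs≡ : (ℤ.+ b ℤ.* ℤ.+ b ℤ.* ℤ.+ n) ℤ.* ℤ.+ 1 ≡ ℤ.+ (b * b * n)
    lhs≡ = trans (ℤ.*-identityʳ (ℤ.+ b ℤ.* ℤ.+ b ℤ.* ℤ.+ n))
      (trans (cong (ℤ._* ℤ.+ n) (sym (ℤ.pos-* b b))) (sym (ℤ.pos-* (b * b) n)))
    rhs≡ : ℤ.+ 1 ℤ.* ℤ.+ (D * D * 1) ≡ ℤ.+ (D * D)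
    rhs≡ = trans (ℤ.*-identityˡ (ℤ.+ (D * D * 1))) (cong ℤ.+_ (*-identityʳ (D * D)))

proposition1p4 : ∃[ C ] (0ℚᵘ <ℚ C ×
    (∀ (n : ℕ) → 0 < n → 2 ∣ n → (i : Fin n) →
    Pr n (λ x → lookup (ψ x) (inject₁ i) ≟ lookup x i) >1- C /√ n))
-- C = 1 works because `Σ₁-hits*surv²` is strict and carries no further constant.
proposition1p4 = 1ℚᵘ , *<* (+<+ ≤-refl) , λ n _ _ i →
  let agree? = λ (x : Bits n) → lookup (ψ x) (inject₁ i) ≟ lookup x i
      G = length (filter agree? (allBits n))
      r = n ∸ suc (toℕ i)
      -- Counts the levels t at which x can have bit i changed; summed over all x it gives `bound`.
      flips : Bits n → ℕ
      flips x = Σ₁ (λ t → falls i t t x) n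
      bound = Σ₁ (λ t → hits (toℕ i) t * surv r t) n
      flips≥1 : ∀ x → lookup (ψ x) (inject₁ i) ≢ lookup x i → 1 ≤ flips x
      flips≥1 x neq =
        let t , 1≤t , t≤n , eq = ψ-flip⇒falls x i neq
        in subst (_≤ flips x) eq (term≤Σ₁ (λ t → falls i t t x) 1≤t t≤n)
      ∑flips≡ : ∑bits flips ≡ bound
      ∑flips≡ = trans (sum-map-Σ₁ (λ t → falls i t t) n (allBits n)) (Σ₁-cong n (λ t → ∑bits-falls i t t))
      2^n≤ : 2 ^ n ≤ G + bound
      2^n≤ = subst₂ (λ l b → l ≤ G + b) (length-allBits n) ∑flips≡ (length≤filter+sum agree? flips flips≥1 (allBits n))
      i+r≡n : toℕ i + suc r ≡ n
      i+r≡n = trans (+-suc (toℕ i) r) (m+[n∸m]≡n (toℕ<n i))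
  in >1-intro G (2 ^ n) n {{m^n≢0 2 n}}
       (subst (G ≤_) (length-allBits n) (length-filter agree? (allBits n)))
       (≤-<-trans (*-monoˡ-≤ n (square-mono (m≤n+o⇒m∸n≤o (2 ^ n) G 2^n≤)))
         (subst (bound * bound * n <_) (4^≡2^*2^ n) (Σ₁-hits*surv² (toℕ i) r i+r≡n)))
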